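{- Let $N_1=(V_1,R_1,S_1,\tau_1,d_1,n_1)$ and $N_2=(V_2,R_2,S_2,\tau_2,d_2,n_2)$ be valid NU-systems generating strings $w_1$ and $w_2$, respectively. Then there is a valid NU-system of size $O(size(N_1)+size(N_2))$ generating $w_1\cdot w_2$, and (when $w_1\in V_2^*$) there is a valid NU-system of size $O(size(N_1)+size(N_2))$ generating the composition of $w_1$ and $w_2$, namely the string generated by the NU-system $(V_2,R_2,w_1,\tau_2,d_2,n_2)$ whose axiom is $w_1$.
   Context: NU-system: a tuple $N=(V,R,S,\tau,d,n)$ where $V$ is a finite set of variables, $S\in V^*$ is the axiom, $\tau:V\to V$ is a coding (letter-to-letter, extended letter-wise), $d,n\in\mathbb{N}$, and $R$ assigns to each $A\in V$ a right-hand side $R(A)\in(V\cup E)^+$, where $E=\{A(l)[i,j] : A\in V,\ l,i,j\in\mathbb{N}\}$ is the set of extraction symbols. For a variable $A$ let $A_0=A$ and let $A_{l+1}$ be obtained from $A_l$ by replacing each variable $B$ by $R(B)$, where every extraction symbol $B(l')[i,j]$ in a right-hand side is in turn replaced by the string $\tau(B_{l'}[i,j])\in V^*$ (its $l'$-level expansion, with extractions recursively resolved, restricted to positions $i..j$ and mapped by $\tau$); this replacement counts as a single level. The levels of $N$ are $L_0=S$ and $L_{i+1}$ obtained from $L_i$ in the same way. $A(l)$ abbreviates $A(l)[1,|A_l|]$. $N$ is valid if this recursive resolution has no circular dependencies, so all levels are uniquely determined; it then generates $w[1,n]=\tau(L_d[1,n])$. Its size $size(N)$ is $|S|+\sum_{A\in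 V}|R(A)|$, each extraction symbol counting as one. The $O(\cdot)$ hides an absolute constant. -}

module Defs where

open import Data.Nat using (ℕ; zero; suc; _+_; _*_; _∸_; _≤_)
open import Data.List using (List; []; _∷_; _++_; length; map; take; drop)
open import Data.Nat.ListAction using (sum)
open import Data.List.Membership.Propositional using (_∈_)
open import Data.List.Relation.Unary.All using (All)
open import Data.List.Relation.Unary.Unique.Propositional using (Unique)
open import Data.Product using (_×_; ∃-syntax)
open import Relation.Binary.PropositionalEquality using (_≡_; _≢_)

-- Variables are named by natural numbers; the finite variable set V is a
-- duplicate-free list of names.  Strings over V are lists of names.

data Sym : Set where
  var : ℕ → Sym
  ext : (A l i j : ℕ) → Sym

record NU : Set where
  field
    V : List ℕ
    R : ℕ → List Sym
    S : List ℕ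
    τ : ℕ → ℕ
    d : ℕ
    n : ℕ
open NU public

SymIn : List ℕ → Sym → Set
SymIn V (var B) = B ∈ V
SymIn V (ext B l i j) = B ∈ V

WellFormed : NU → Set
WellFormed N =
  Unique (V N)
  × All (_∈ V N) (S N)
  × (∀ A → A ∈ V N → τ N A ∈ V N)
  × (∀ A → A ∈ V N → R N A ≢ [])
  × (∀ A → A ∈ V N → All (SymIn (V N)) (R N A))

-- s[i,j] (1-based, inclusive); only used when 1 ≤ i ≤ j ≤ |s|.
sub : List ℕ → ℕ → ℕ → List ℕ
sub s i j = take (suc j ∸ i) (drop (i ∸ 1) s)

-- Semantics (least-fixed-point, i.e. well-founded resolution):
--   Lev N A l s      : A_l = s
--   Step N u s       : s is obtained from u by replacing each variable B by R(B)
--                      with its extraction symbols resolved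
--   Res N rhs s      : the right-hand side rhs resolves to s
mutual
  data Lev (N : NU) : ℕ → ℕ → List ℕ → Set where
    lev0 : ∀ A → Lev N A zero (A ∷ [])
    levS : ∀ {A l u s} → Lev N A l u → Step N u s → Lev N A (suc l) s

  data Step (N : NU) : List ℕ → List ℕ → Set where
    step[] : Step N [] []
    step∷  : ∀ {B u r s} → Res N (R N B) r → Step N u s → Step N (B ∷ u) (r ++ s)

  data Res (N : NU) : List Sym → List ℕ → Set where
    res[]  : Res N [] []
    resVar : ∀ {C xs r} → Res N xs r → Res N (var C ∷ xs) (C ∷ r)
    resExt : ∀ {C l i j t xs r} → Lev N C l t → 1 ≤ i → i ≤ j → j ≤ length t →
             Res N xs r → Res N (ext C l i j ∷ xs) (map (τ N) (sub t i j) ++ r)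

data Level (N : NU) : ℕ → List ℕ → Set where
  L0 : Level N zero (S N)
  LS : ∀ {k u s} → Level N k u → Step N u s → Level N (suc k) s

-- Valid: well-formed and the recursive resolution is well-founded, so every
-- A_l (A ∈ V, l ∈ ℕ) is determined (uniqueness follows from determinism of
-- the rules).
Valid : NU → Set
Valid N = WellFormed N × (∀ A → A ∈ V N → ∀ l → ∃[ s ] Lev N A l s)

Generates : NU → List ℕ → Set
Generates N w = Valid N ×
  ∃[ L ] (Level N (d N) L × n N ≤ length L × w ≡ map (τ N) (take (n N) L))

size : NU → ℕ
size N = length (S N) + sum (map (λ A → length (R N A)) (V N))

withAxiom : NU → List ℕ → NU
withAxiom N w = record N { S = w }

{-# OPTIONS --safe #-}

-- The obstruction to merging two systems is that τ plays two roles: inside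
-- extraction symbols it must stay within one system's own alphabet, while the
-- last coding has to leave that alphabet.  So every derivation step of N is
-- stretched to two, a# → a^ → R(a)#: even levels consist of letters a#, odd ones
-- of letters a^.  Extractions from A(l) become extractions from A#(2l) and use
-- τ(a#) = τ(a)#, whereas extracting an odd level applies τ(a^) = τ(a), a letter
-- outside the copy.  Hence a single extraction symbol imports the whole string
-- generated by N into any host system containing its letters.

module Submission where

open import Defs
open import Data.Nat using (ℕ; zero; suc; _+_; _*_; _∸_; _≤_; _<_; z≤n; s≤s; _<?_; _≟_)
open import Data.Nat.Properties
open import Data.Nat.ListAction using (sum)
open import Data.Nat.ListAction.Properties using (sum-++)
open import Data.Nat.Tactic.RingSolver using (solve-∀)
open import Data.List using (List; []; _∷_; _++_; length; map; take; drop; deduplicate)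
open import Data.List.Properties
  using (map-++; map-∘; map-cong; map-cong-local; map-id-local; length-map; length-++;
         take-map; drop-map; take-all; take-[]; ++-identityʳ; length-deduplicate)
open import Data.List.Extrema.Nat using (max; xs≤max)
open import Data.List.Membership.Propositional using (_∈_)
open import Data.List.Membership.DecPropositional _≟_ using (_∈?_)
open import Data.Empty using (⊥)
open import Data.List.Membership.Propositional.Properties
  using (∈-map⁺; ∈-map⁻; ∈-++⁺ˡ; ∈-++⁺ʳ; ∈-deduplicate⁺)
open import Data.List.Relation.Unary.All as All using (All; []; _∷_)
import Data.List.Relation.Unary.All.Properties as Allₚ
open import Data.List.Relation.Unary.Any using (here; there)
open import Data.List.Relation.Unary.AllPairs using (_∷_)
open import Data.List.Relation.Unary.Unique.Propositional using (Unique)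
import Data.List.Relation.Unary.Unique.Propositional.Properties as Uniqueₚ
open import Data.List.Relation.Unary.Unique.DecPropositional.Properties _≟_ using (deduplicate-!)
open import Data.Product using (_×_; _,_; ∃-syntax; proj₁; proj₂)
open import Function using (_∘_; id)
open import Relation.Nullary using (yes; no; contradiction)
open import Relation.Binary.PropositionalEquality

private variable
  X : Set
  N N′ : NU
  A l k : ℕ
  u s w : List ℕ
  xs : List Sym

map-≢[] : {Y : Set} {f : X → Y} {ys : List X} → ys ≢ [] → map f ys ≢ []
map-≢[] {ys = []}    ys≢[] _ = ys≢[] refl

≢[]⇒1≤length : {ys : List X} → ys ≢ [] → 1 ≤ length ys
≢[]⇒1≤length {ys = []}    ys≢[] = contradiction refl ys≢[]
≢[]⇒1≤length {ys = _ ∷ _} _     = s≤s z≤n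

sub-map : (f : ℕ → ℕ) (t : List ℕ) (i j : ℕ) → sub (map f t) i j ≡ map f (sub t i j)
sub-map f t i j = begin
  take (suc j ∸ i) (drop (i ∸ 1) (map f t)) ≡⟨ cong (take (suc j ∸ i)) (drop-map (i ∸ 1) t) ⟩
  take (suc j ∸ i) (map f (drop (i ∸ 1) t)) ≡⟨ take-map (suc j ∸ i) (drop (i ∸ 1) t) ⟩
  map f (sub t i j)                         ∎
  where open ≡-Reasoning

rulesSize : NU → ℕ
rulesSize N = sum (map (λ A → length (R N A)) (V N))

length≤sum : (f : ℕ → ℕ) {ys : List ℕ} → All (λ y → 1 ≤ f y) ys → length ys ≤ sum (map f ys)
length≤sum f []         = z≤n
length≤sum f (py ∷ pys) = +-mono-≤ py (length≤sum f pys)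

sum-map-≡1 : (f : ℕ → ℕ) {ys : List ℕ} → All (λ y → f y ≡ 1) ys → sum (map f ys) ≡ length ys
sum-map-≡1 f []         = refl
sum-map-≡1 f (py ∷ pys) = cong₂ _+_ py (sum-map-≡1 f pys)

length-V≤rulesSize : ∀ N → WellFormed N → length (V N) ≤ rulesSize N
length-V≤rulesSize _ (_ , _ , _ , R≢[] , _) =
  length≤sum _ (All.tabulate λ A∈V → ≢[]⇒1≤length (R≢[] _ A∈V))

res-vars : (u : List ℕ) → Res N (map var u) u
res-vars []      = res[]
res-vars (_ ∷ u) = resVar (res-vars u)

lev-one : Res N (R N A) s → Lev N A 1 s
lev-one {N} r = subst (Lev N _ 1) (++-identityʳ _) (levS (lev0 _) (step∷ r step[]))

level-of-[] : S N ≡ [] → Level N k s → s ≡ []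
level-of-[] S≡[] L0 = S≡[]
level-of-[] S≡[] (LS p st) with refl ← level-of-[] S≡[] p with step[] ← st = refl

axiom-≢[] : Generates N w → w ≢ [] → S N ≢ []
axiom-≢[] {N} (_ , _ , level , _ , refl) w≢[] S≡[] with refl ← level-of-[] S≡[] level =
  w≢[] (cong (map (τ N)) (take-[] (n N)))

module Closure (N : NU) (wf : WellFormed N) where

  S⊆V : All (_∈ V N) (S N)
  S⊆V = proj₁ (proj₂ wf)

  R≢[] : ∀ A → A ∈ V N → R N A ≢ []
  R≢[] = proj₁ (proj₂ (proj₂ (proj₂ wf)))

  τ∈V : ∀ A → A ∈ V N → τ N A ∈ V N
  τ∈V = proj₁ (proj₂ (proj₂ wf))

  R-closed : ∀ A → A ∈ V N → All (SymIn (V N)) (R N A)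
  R-closed = proj₂ (proj₂ (proj₂ (proj₂ wf)))

  mutual
    lev-closed : A ∈ V N → Lev N A l s → All (_∈ V N) s
    lev-closed A∈V (lev0 _)   = A∈V ∷ []
    lev-closed A∈V (levS p q) = step-closed (lev-closed A∈V p) q

    step-closed : All (_∈ V N) u → Step N u s → All (_∈ V N) s
    step-closed []         step[]      = []
    step-closed (b∈ ∷ u∈) (step∷ p ps) =
      Allₚ.++⁺ (res-closed (R-closed _ b∈) p) (step-closed u∈ ps)

    res-closed : All (SymIn (V N)) xs → Res N xs s → All (_∈ V N) s
    res-closed []        res[]       = []
    res-closed (c∈ ∷ x∈) (resVar p) = c∈ ∷ res-closed x∈ p
    res-closed (c∈ ∷ x∈) (resExt {i = i} {j} p _ _ _ ps) =
      Allₚ.++⁺ (Allₚ.map⁺ (All.map (τ∈V _) (sub-closed i j (lev-closed c∈ p))))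
               (res-closed x∈ ps)

    sub-closed : ∀ {t} i j → All (_∈ V N) t → All (_∈ V N) (sub t i j)
    sub-closed i j t∈ = Allₚ.take⁺ (suc j ∸ i) (Allₚ.drop⁺ (i ∸ 1) t∈)

  level-closed : Level N k s → All (_∈ V N) s
  level-closed L0       = S⊆V
  level-closed (LS p q) = step-closed (level-closed p) q

Resolvable : NU → ℕ → Set
Resolvable N A = ∃[ r ] Res N (R N A) r

valid⇒resolvable : Valid N → ∀ A → A ∈ V N → Resolvable N A
valid⇒resolvable (_ , total) A A∈V with total A A∈V 1
... | _ , levS (lev0 _) (step∷ r step[]) = _ , r

resolvable⇒valid : WellFormed N → (∀ A → A ∈ V N → Resolvable N A) → Valid N
resolvable⇒valid {N} wf resolvable = wf , total
  where
  open Closure N wf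
  step-total : All (_∈ V N) u → ∃[ s ] Step N u s
  step-total []         = [] , step[]
  step-total (b∈ ∷ u∈) =
    _ , step∷ (proj₂ (resolvable _ b∈)) (proj₂ (step-total u∈))

  total : ∀ A → A ∈ V N → ∀ l → ∃[ s ] Lev N A l s
  total A A∈V zero    = _ , lev0 A
  total A A∈V (suc l) with _ , p ← total A A∈V l =
    _ , levS p (proj₂ (step-total (lev-closed A∈V p)))

record Extends (N N′ : NU) : Set where
  field
    V⊆ : ∀ {A} → A ∈ V N → A ∈ V N′
    R≡ : ∀ {A} → A ∈ V N → R N′ A ≡ R N A
    τ≡ : ∀ {A} → A ∈ V N → τ N′ A ≡ τ N A

Extends-trans : ∀ {N″} → Extends N N′ → Extends N′ N″ → Extends N N″
Extends-trans e f = record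
  { V⊆ = F.V⊆ ∘ E.V⊆
  ; R≡ = λ A∈ → trans (F.R≡ (E.V⊆ A∈)) (E.R≡ A∈)
  ; τ≡ = λ A∈ → trans (F.τ≡ (E.V⊆ A∈)) (E.τ≡ A∈)
  }
  where
  module E = Extends e
  module F = Extends f

module Lift {N N′ : NU} (wf : WellFormed N) (e : Extends N N′) where
  open Closure N wf
  open Extends e

  mutual
    lev-lift : A ∈ V N → Lev N A l s → Lev N′ A l s
    lev-lift A∈V (lev0 A)   = lev0 A
    lev-lift A∈V (levS p q) = levS (lev-lift A∈V p) (step-lift (lev-closed A∈V p) q)

    step-lift : All (_∈ V N) u → Step N u s → Step N′ u s
    step-lift []         step[]      = step[]
    step-lift (b∈ ∷ u∈) (step∷ p ps) = step∷ (rule-lift b∈ p) (step-lift u∈ ps)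

    rule-lift : A ∈ V N → Res N (R N A) s → Res N′ (R N′ A) s
    rule-lift A∈V p rewrite R≡ A∈V = res-lift (R-closed _ A∈V) p

    res-lift : All (SymIn (V N)) xs → Res N xs s → Res N′ xs s
    res-lift []        res[]      = res[]
    res-lift (c∈ ∷ x∈) (resVar p) = resVar (res-lift x∈ p)
    res-lift (c∈ ∷ x∈) (resExt {i = i} {j} {r = r} p 1≤i i≤j j≤ ps) =
      subst (λ t → Res N′ _ (t ++ r))
        (map-cong-local (All.map τ≡ (sub-closed i j (lev-closed c∈ p))))
        (resExt (lev-lift c∈ p) 1≤i i≤j j≤ (res-lift x∈ ps))

  symIn-lift : ∀ {x} → SymIn (V N) x → SymIn (V N′) x
  symIn-lift {var _}       = V⊆
  symIn-lift {ext _ _ _ _} = V⊆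

reaxiom : NU → List ℕ → ℕ → ℕ → NU
reaxiom N S′ d′ n′ = record N { S = S′ ; d = d′ ; n = n′ }

reaxiom-extends : ∀ {S′ d′ n′} → Extends N (reaxiom N S′ d′ n′)
reaxiom-extends = record { V⊆ = id ; R≡ = λ _ → refl ; τ≡ = λ _ → refl }

reaxiom-valid : ∀ {S′ d′ n′} → All (_∈ V N) S′ → Valid N → Valid (reaxiom N S′ d′ n′)
reaxiom-valid {N} S′⊆V (wf@(uniq , _ , rest) , total) =
  (uniq , S′⊆V , rest) ,
  λ A A∈V l → _ , Lift.lev-lift wf reaxiom-extends A∈V (proj₂ (total A A∈V l))

data Fresh : Set where
  start root : Fresh
  hash hat   : ℕ → Fresh

code : Fresh → ℕ
code start    = 0
code root     = 1
code (hash a) = 2 + a * 2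
code (hat a)  = 3 + a * 2

next : Fresh → Fresh
next (hash a) = hash (suc a)
next (hat a)  = hat (suc a)
next x        = x

decode : ℕ → Fresh
decode 0 = start
decode 1 = root
decode 2 = hash 0
decode 3 = hat 0
decode (suc (suc m@(suc (suc _)))) = next (decode m)

decode-code : ∀ x → decode (code x) ≡ x
decode-code start          = refl
decode-code root           = refl
decode-code (hash zero)    = refl
decode-code (hash (suc a)) = cong next (decode-code (hash a))
decode-code (hat zero)     = refl
decode-code (hat (suc a))  = cong next (decode-code (hat a))

override : ℕ → (ℕ → X) → (Fresh → X) → ℕ → X
override m f g x with x <? m
... | yes _ = f x
... | no  _ = g (decode (x ∸ m))

override-< : ∀ {m x} (f : ℕ → X) g → x < m → override m f g x ≡ f x
override-< {m = m} {x} f g x<m with x <? m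
... | yes _   = refl
... | no  x≮m = contradiction x<m x≮m

override-fresh : ∀ m (f : ℕ → X) g y → override m f g (m + code y) ≡ g y
override-fresh m f g y with m + code y <? m
... | yes lt = contradiction lt (m+n≮m m (code y))
... | no  _  = cong g (trans (cong decode (m+n∸m≡n m (code y))) (decode-code y))

record Imported (H N : NU) (w : List ℕ) : Set where
  field
    system    : NU
    handle    : ℕ
    extends   : Extends H system
    valid     : Valid system
    handle∈V  : handle ∈ V system
    resolves  : Res system (R system handle) w
    size-rule : rulesSize system ≤ rulesSize H + 2 * size N

module Import (H N : NU) (H-valid : Valid H) (N-valid : Valid N)
              {L : List ℕ} (L-level : Level N (d N) L) (n≤ : n N ≤ length L)
              (w≢[] : map (τ N) (take (n N) L) ≢ [])
              (w⊆H : All (_∈ V H) (map (τ N) (take (n N) L)))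
  where

  H-wf = proj₁ H-valid
  N-wf = proj₁ N-valid

  module H-wf = Closure H H-wf
  module N-wf = Closure N N-wf

  bound : ℕ
  bound = suc (max 0 (V H))

  V-bounded : ∀ {x} → x ∈ V H → x < bound
  V-bounded x∈ = s≤s (All.lookup (xs≤max 0 (V H)) x∈)

  name : Fresh → ℕ
  name x = bound + code x

  name-injective : ∀ {x y} → name x ≡ name y → x ≡ y
  name-injective {x} {y} eq = begin
    x               ≡⟨ decode-code x ⟨
    decode (code x) ≡⟨ cong decode (+-cancelˡ-≡ bound _ _ eq) ⟩
    decode (code y) ≡⟨ decode-code y ⟩
    y               ∎
    where open ≡-Reasoning

  # ^ : ℕ → ℕ
  # = name ∘ hash
  ^ = name ∘ hat

  #Sym : Sym → Sym
  #Sym (var A)       = var (# A)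
  #Sym (ext A l i j) = ext (# A) (l * 2) i j

  -- The imported string uses letters of H only, but other letters of N may be
  -- coded outside H; sending those to an arbitrary letter keeps the system closed.
  out : ℕ → ℕ
  out a with τ N a ∈? V H
  ... | yes _ = τ N a
  ... | no  _ = name root

  out-≡ : ∀ {a} → τ N a ∈ V H → out a ≡ τ N a
  out-≡ {a} τ∈ with τ N a ∈? V H
  ... | yes _  = refl
  ... | no  τ∉ = contradiction τ∈ τ∉

  rule : Fresh → List Sym
  rule start    = map var (map # (S N))
  rule root     = ext (name start) (2 + d N * 2) 1 (n N) ∷ []
  rule (hash a) = var (^ a) ∷ []
  rule (hat a)  = map #Sym (R N a)

  coding : Fresh → ℕ
  coding start    = name start
  coding root     = name root
  coding (hash a) = # (τ N a)
  coding (hat a)  = out a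

  fresh : List Fresh
  fresh = start ∷ root ∷ map hash (V N) ++ map hat (V N)

  system : NU
  system = record
    { V = V H ++ map name fresh
    ; R = override bound (R H) rule
    ; S = S H
    ; τ = override bound (τ H) coding
    ; d = d H
    ; n = n H
    }

  R-fresh : ∀ x → R system (name x) ≡ rule x
  R-fresh = override-fresh bound (R H) rule

  τ-fresh : ∀ x → τ system (name x) ≡ coding x
  τ-fresh = override-fresh bound (τ H) coding

  extends : Extends H system
  extends = record
    { V⊆ = ∈-++⁺ˡ
    ; R≡ = λ A∈ → override-< (R H) rule (V-bounded A∈)
    ; τ≡ = λ A∈ → override-< (τ H) coding (V-bounded A∈)
    }

  open Extends extends
  open Lift H-wf extends

  rule-res : ∀ x → Res system (rule x) s → Res system (R system (name x)) s
  rule-res x = subst (λ xs → Res system xs _) (sym (R-fresh x))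

  step-hat : ∀ u → Step system (map # u) (map ^ u)
  step-hat []      = step[]
  step-hat (a ∷ u) = step∷ (rule-res (hash a) (resVar res[])) (step-hat u)

  mutual
    lev-double : Lev N A l s → Lev system (# A) (l * 2) (map # s)
    lev-double (lev0 A)   = lev0 (# A)
    lev-double (levS p q) = levS (levS (lev-double p) (step-hat _)) (step-hash q)

    step-hash : Step N u s → Step system (map ^ u) (map # s)
    step-hash step[] = step[]
    step-hash (step∷ {B} {r = r} {s} p q) =
      subst (Step system _) (sym (map-++ # r s))
        (step∷ (rule-res (hat B) (res-hash p)) (step-hash q))

    res-hash : Res N xs s → Res system (map #Sym xs) (map # s)
    res-hash res[]      = res[]
    res-hash (resVar p) = resVar (res-hash p)
    res-hash (resExt {i = i} {j} {t} {r = r} p 1≤i i≤j j≤ q) =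
      subst (Res system _) eq
        (resExt (lev-double p) 1≤i i≤j (subst (j ≤_) (sym (length-map # t)) j≤) (res-hash q))
      where
      open ≡-Reasoning
      eq : map (τ system) (sub (map # t) i j) ++ map # r ≡ map # (map (τ N) (sub t i j) ++ r)
      eq = begin
        map (τ system) (sub (map # t) i j) ++ map # r
          ≡⟨ cong (λ v → map (τ system) v ++ map # r) (sub-map # t i j) ⟩
        map (τ system) (map # (sub t i j)) ++ map # r
          ≡⟨ cong (_++ map # r) (map-∘ (sub t i j)) ⟨
        map (τ system ∘ #) (sub t i j) ++ map # r
          ≡⟨ cong (_++ map # r) (map-cong (τ-fresh ∘ hash) (sub t i j)) ⟩
        map (# ∘ τ N) (sub t i j) ++ map # r
          ≡⟨ cong (_++ map # r) (map-∘ (sub t i j)) ⟩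
        map # (map (τ N) (sub t i j)) ++ map # r
          ≡⟨ map-++ # (map (τ N) (sub t i j)) r ⟨
        map # (map (τ N) (sub t i j) ++ r) ∎

  lev-start : Level N k s → Lev system (name start) (suc (k * 2)) (map # s)
  lev-start L0       = lev-one (rule-res start (res-vars _))
  lev-start (LS p q) = levS (levS (lev-start p) (step-hat _)) (step-hash q)

  n≥1 : 1 ≤ n N
  n≥1 = n≥1′ (n N) refl
    where
    n≥1′ : ∀ m → n N ≡ m → 1 ≤ m
    n≥1′ zero    n≡0 = contradiction (cong (λ m → map (τ N) (take m L)) n≡0) w≢[]
    n≥1′ (suc m) _   = s≤s z≤n

  root-res : Res system (rule root) (map (τ N) (take (n N) L))
  root-res = subst (Res system _) eq
    (resExt (levS (lev-start L-level) (step-hat L)) ≤-refl n≥1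
            (subst (n N ≤_) (sym (length-map ^ L)) n≤) res[])
    where
    open ≡-Reasoning
    eq : map (τ system) (take (n N) (map ^ L)) ++ [] ≡ map (τ N) (take (n N) L)
    eq = begin
      map (τ system) (take (n N) (map ^ L)) ++ [] ≡⟨ ++-identityʳ _ ⟩
      map (τ system) (take (n N) (map ^ L))       ≡⟨ cong (map (τ system)) (take-map (n N) L) ⟩
      map (τ system) (map ^ (take (n N) L))       ≡⟨ map-∘ (take (n N) L) ⟨
      map (τ system ∘ ^) (take (n N) L)           ≡⟨ map-cong (τ-fresh ∘ hat) (take (n N) L) ⟩
      map out (take (n N) L)                      ≡⟨ map-cong-local (All.map out-≡ (Allₚ.map⁻ w⊆H)) ⟩
      map (τ N) (take (n N) L)                    ∎

  S≢[] : S N ≢ []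
  S≢[] = axiom-≢[] (N-valid , L , L-level , n≤ , refl) w≢[]

  all-fresh : {P : ℕ → Set} → P (name start) → P (name root) →
              (∀ a → a ∈ V N → P (# a)) → (∀ a → a ∈ V N → P (^ a)) → All P (map name fresh)
  all-fresh ps pr p# p^ = Allₚ.map⁺ {xs = fresh} (ps ∷ pr ∷
    Allₚ.++⁺ (Allₚ.map⁺ (All.tabulate (p# _))) (Allₚ.map⁺ (All.tabulate (p^ _))))

  all-V : {P : ℕ → Set} → (∀ A → A ∈ V H → P A) → P (name start) → P (name root) →
          (∀ a → a ∈ V N → P (# a)) → (∀ a → a ∈ V N → P (^ a)) → ∀ A → A ∈ V system → P A
  all-V pH ps pr p# p^ A A∈ =
    All.lookup (Allₚ.++⁺ (All.tabulate (pH _)) (all-fresh ps pr p# p^)) A∈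

  fresh-unique : Unique fresh
  fresh-unique =
    ((λ ()) ∷ outside (λ _ ()) (λ _ ())) ∷
    outside (λ _ ()) (λ _ ()) ∷
    Uniqueₚ.++⁺ (Uniqueₚ.map⁺ (λ { refl → refl }) (proj₁ N-wf))
                (Uniqueₚ.map⁺ (λ { refl → refl }) (proj₁ N-wf))
                λ { (p , q) → hash≢hat (∈-map⁻ hash p) (∈-map⁻ hat q) }
    where
    outside : ∀ {x} → (∀ a → x ≢ hash a) → (∀ a → x ≢ hat a) →
              All (x ≢_) (map hash (V N) ++ map hat (V N))
    outside ≢hash ≢hat = Allₚ.++⁺ (Allₚ.map⁺ (All.universal ≢hash (V N)))
                                  (Allₚ.map⁺ (All.universal ≢hat (V N)))

    hash≢hat : ∀ {x} → ∃[ a ] (a ∈ V N × x ≡ hash a) → ∃[ a ] (a ∈ V N × x ≡ hat a) → ⊥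
    hash≢hat (_ , _ , refl) (_ , _ , ())

  V-unique : Unique (V system)
  V-unique = Uniqueₚ.++⁺ (proj₁ H-wf) (Uniqueₚ.map⁺ name-injective fresh-unique) disjoint
    where
    disjoint : ∀ {x} → x ∈ V H × x ∈ map name fresh → ⊥
    disjoint (p , q) with y , _ , refl ← ∈-map⁻ name {xs = fresh} q = m+n≮m bound (code y) (V-bounded p)

  fresh∈V : ∀ {x} → x ∈ fresh → name x ∈ V system
  fresh∈V = ∈-++⁺ʳ (V H) ∘ ∈-map⁺ name

  start∈V : name start ∈ V system
  start∈V = fresh∈V (here refl)

  root∈V : name root ∈ V system
  root∈V = fresh∈V (there (here refl))

  #∈V : ∀ {a} → a ∈ V N → # a ∈ V system
  #∈V a∈ = fresh∈V (there (there (∈-++⁺ˡ (∈-map⁺ hash a∈))))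

  ^∈V : ∀ {a} → a ∈ V N → ^ a ∈ V system
  ^∈V a∈ = fresh∈V (there (there (∈-++⁺ʳ (map hash (V N)) (∈-map⁺ hat a∈))))

  out∈V : ∀ a → out a ∈ V system
  out∈V a with τ N a ∈? V H
  ... | yes τ∈ = V⊆ τ∈
  ... | no  _  = root∈V

  #Sym-in : ∀ {x} → SymIn (V N) x → SymIn (V system) (#Sym x)
  #Sym-in {var _}       = #∈V
  #Sym-in {ext _ _ _ _} = #∈V

  τ-closed : ∀ A → A ∈ V system → τ system A ∈ V system
  τ-closed = all-V
    (λ A A∈ → subst (_∈ V system) (sym (τ≡ A∈)) (V⊆ (H-wf.τ∈V A A∈)))
    (at start start∈V) (at root root∈V)
    (λ a a∈ → at (hash a) (#∈V (N-wf.τ∈V a a∈))) (λ a _ → at (hat a) (out∈V a))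
    where
    at : ∀ x → coding x ∈ V system → τ system (name x) ∈ V system
    at x = subst (_∈ V system) (sym (τ-fresh x))

  R-nonempty : ∀ A → A ∈ V system → R system A ≢ []
  R-nonempty = all-V
    (λ A A∈ → subst (_≢ []) (sym (R≡ A∈)) (H-wf.R≢[] A A∈))
    (at start (map-≢[] (map-≢[] S≢[]))) (at root λ ())
    (λ a _ → at (hash a) λ ()) (λ a a∈ → at (hat a) (map-≢[] (N-wf.R≢[] a a∈)))
    where
    at : ∀ x → rule x ≢ [] → R system (name x) ≢ []
    at x = subst (_≢ []) (sym (R-fresh x))

  R-closed : ∀ A → A ∈ V system → All (SymIn (V system)) (R system A)
  R-closed = all-V
    (λ A A∈ → subst (All _) (sym (R≡ A∈)) (All.map (λ {x} → symIn-lift {x}) (H-wf.R-closed A A∈)))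
    (at start (Allₚ.map⁺ (Allₚ.map⁺ (All.map #∈V N-wf.S⊆V))))
    (at root (start∈V ∷ []))
    (λ a a∈ → at (hash a) (^∈V a∈ ∷ []))
    (λ a a∈ → at (hat a) (Allₚ.map⁺ (All.map (λ {x} → #Sym-in {x}) (N-wf.R-closed a a∈))))
    where
    at : ∀ x → All (SymIn (V system)) (rule x) → All (SymIn (V system)) (R system (name x))
    at x = subst (All _) (sym (R-fresh x))

  valid : Valid system
  valid = resolvable⇒valid
    (V-unique , All.map V⊆ H-wf.S⊆V , τ-closed , R-nonempty , R-closed)
    (all-V
      (λ A A∈ → _ , rule-lift A∈ (proj₂ (valid⇒resolvable H-valid A A∈)))
      (_ , rule-res start (res-vars _))
      (_ , rule-res root root-res)
      (λ a _ → _ , rule-res (hash a) (resVar res[]))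
      (λ a a∈ → _ , rule-res (hat a) (res-hash (proj₂ (valid⇒resolvable N-valid a a∈)))))

  cost : ℕ → ℕ
  cost = length ∘ R system

  cost-fresh : ∀ (f : ℕ → Fresh) (ys : List ℕ) →
               map cost (map name (map f ys)) ≡ map (length ∘ rule ∘ f) ys
  cost-fresh f []       = refl
  cost-fresh f (y ∷ ys) = cong₂ _∷_ (cong length (R-fresh (f y))) (cost-fresh f ys)

  rulesSize-≡ : rulesSize system ≡ rulesSize H + (length (S N) + (1 + (length (V N) + rulesSize N)))
  rulesSize-≡ = begin
    sum (map cost (V H ++ map name fresh))
      ≡⟨ sum-map-++ (V H) (map name fresh) ⟩
    sum (map cost (V H)) + sum (map cost (map name fresh))
      ≡⟨ cong₂ _+_ host-cost (cong₂ _+_ start-cost (cong₂ _+_ (cong length (R-fresh root)) copy-cost)) ⟩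
    rulesSize H + (length (S N) + (1 + (length (V N) + rulesSize N))) ∎
    where
    open ≡-Reasoning
    sum-map-++ : ∀ ys zs → sum (map cost (ys ++ zs)) ≡ sum (map cost ys) + sum (map cost zs)
    sum-map-++ ys zs = trans (cong sum (map-++ cost ys zs)) (sum-++ (map cost ys) _)

    host-cost : sum (map cost (V H)) ≡ rulesSize H
    host-cost = cong sum (map-cong-local (All.tabulate (cong length ∘ R≡)))

    start-cost : cost (name start) ≡ length (S N)
    start-cost = trans (cong length (R-fresh start)) (trans (length-map var (map # (S N))) (length-map # (S N)))

    #-cost : sum (map cost (map name (map hash (V N)))) ≡ length (V N)
    #-cost = trans (cong sum (cost-fresh hash (V N))) (sum-map-≡1 _ (All.tabulate {xs = V N} λ _ → refl))

    ^-cost : sum (map cost (map name (map hat (V N)))) ≡ rulesSize N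
    ^-cost = cong sum (trans (cost-fresh hat (V N)) (map-cong (λ a → length-map #Sym (R N a)) (V N)))

    copy-cost : sum (map cost (map name (map hash (V N) ++ map hat (V N)))) ≡ length (V N) + rulesSize N
    copy-cost = begin
      sum (map cost (map name (map hash (V N) ++ map hat (V N))))
        ≡⟨ cong (sum ∘ map cost) (map-++ name (map hash (V N)) (map hat (V N))) ⟩
      sum (map cost (map name (map hash (V N)) ++ map name (map hat (V N))))
        ≡⟨ sum-map-++ (map name (map hash (V N))) _ ⟩
      sum (map cost (map name (map hash (V N)))) + sum (map cost (map name (map hat (V N))))
        ≡⟨ cong₂ _+_ #-cost ^-cost ⟩
      length (V N) + rulesSize N ∎

  rulesSize-≤ : rulesSize system ≤ rulesSize H + 2 * size N
  rulesSize-≤ = begin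
    rulesSize system                                  ≡⟨ rulesSize-≡ ⟩
    rulesSize H + (x + (1 + (length (V N) + y)))
      ≤⟨ +-monoʳ-≤ (rulesSize H) (+-monoʳ-≤ x
           (+-mono-≤ (≢[]⇒1≤length S≢[]) (+-monoˡ-≤ y (length-V≤rulesSize N N-wf)))) ⟩
    rulesSize H + (x + (x + (y + y)))                 ≡⟨ cong (rulesSize H +_) (doubled x y) ⟩
    rulesSize H + 2 * size N                          ∎
    where
    open ≤-Reasoning
    x = length (S N)
    y = rulesSize N
    doubled : ∀ x y → x + (x + (y + y)) ≡ 2 * (x + y)
    doubled = solve-∀

import-string : ∀ {H} → Valid H → Generates N w → w ≢ [] → All (_∈ V H) w → Imported H N w
import-string {N} {H = H} H-valid (N-valid , L , level , n≤ , refl) w≢[] w⊆H = record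
  { system    = system
  ; handle    = name root
  ; extends   = extends
  ; valid     = valid
  ; handle∈V  = root∈V
  ; resolves  = rule-res root root-res
  ; size-rule = rulesSize-≤
  }
  where open Import H N H-valid N-valid level n≤ w≢[] w⊆H

generated-∈V : Generates N w → All (_∈ V N) w
generated-∈V {N} ((wf , _) , L , level , _ , refl) =
  Allₚ.map⁺ (All.map (τ∈V _) (Allₚ.take⁺ (n N) (level-closed level)))
  where open Closure N wf

terminals : List ℕ → NU
terminals u = record
  { V = deduplicate _≟_ u ; R = λ x → var x ∷ [] ; S = [] ; τ = id ; d = 0 ; n = 0 }

terminals-valid : ∀ u → Valid (terminals u)
terminals-valid u = resolvable⇒valid
  (deduplicate-! u , [] , (λ _ → id) , (λ _ _ ()) , λ _ A∈ → A∈ ∷ [])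
  (λ _ _ → _ , resVar res[])

rulesSize-terminals : ∀ u → rulesSize (terminals u) ≤ length u
rulesSize-terminals u = begin
  rulesSize (terminals u)    ≡⟨ sum-map-≡1 _ (All.tabulate {xs = deduplicate _≟_ u} λ _ → refl) ⟩
  length (deduplicate _≟_ u) ≤⟨ length-deduplicate _≟_ u ⟩
  length u                   ∎
  where open ≤-Reasoning

generated-≢[]⇒1≤size : Generates N w → w ≢ [] → 1 ≤ size N
generated-≢[]⇒1≤size {N} g w≢[] =
  ≤-trans (≢[]⇒1≤length (axiom-≢[] g w≢[])) (m≤m+n _ (rulesSize N))

concatenation : ∀ {N₁ N₂ w₁ w₂} → Generates N₁ w₁ → Generates N₂ w₂ → w₁ ≢ [] → w₂ ≢ [] →
                ∃[ M ] (Generates M (w₁ ++ w₂) × size M ≤ 4 * (size N₁ + size N₂))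
concatenation {N₁} {N₂} {w₁} {w₂} g₁ g₂ w₁≢[] w₂≢[] =
  M , (M-valid , w₁ ++ w₂ , level , ≤-refl , sym coded) , bound
  where
  H = terminals (V N₁ ++ V N₂)

  w₁⊆H : All (_∈ V H) w₁
  w₁⊆H = All.map (∈-deduplicate⁺ _≟_ ∘ ∈-++⁺ˡ) (generated-∈V g₁)

  w₂⊆H : All (_∈ V H) w₂
  w₂⊆H = All.map (∈-deduplicate⁺ _≟_ ∘ ∈-++⁺ʳ (V N₁)) (generated-∈V g₂)

  module I₁ = Imported (import-string (terminals-valid _) g₁ w₁≢[] w₁⊆H)
  module I₂ = Imported (import-string I₁.valid g₂ w₂≢[] (All.map (Extends.V⊆ I₁.extends) w₂⊆H))

  M = reaxiom I₂.system (I₁.handle ∷ I₂.handle ∷ []) 1 (length (w₁ ++ w₂))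

  I₁⊆M : Extends I₁.system M
  I₁⊆M = Extends-trans I₂.extends reaxiom-extends

  M-valid : Valid M
  M-valid = reaxiom-valid (Extends.V⊆ I₂.extends I₁.handle∈V ∷ I₂.handle∈V ∷ []) I₂.valid

  level : Level M 1 (w₁ ++ w₂)
  level = subst (λ v → Level M 1 (w₁ ++ v)) (++-identityʳ w₂) (LS L0
    (step∷ (Lift.rule-lift (proj₁ I₁.valid) I₁⊆M I₁.handle∈V I₁.resolves)
    (step∷ (Lift.rule-lift (proj₁ I₂.valid) reaxiom-extends I₂.handle∈V I₂.resolves) step[])))

  coded : map (τ M) (take (length (w₁ ++ w₂)) (w₁ ++ w₂)) ≡ w₁ ++ w₂
  coded = trans (cong (map (τ M)) (take-all _ (w₁ ++ w₂) ≤-refl))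
    (map-id-local (All.map (Extends.τ≡ (Extends-trans I₁.extends I₁⊆M)) (Allₚ.++⁺ w₁⊆H w₂⊆H)))

  H-size : rulesSize H ≤ size N₁ + size N₂
  H-size = begin
    rulesSize H                     ≤⟨ rulesSize-terminals (V N₁ ++ V N₂) ⟩
    length (V N₁ ++ V N₂)           ≡⟨ length-++ (V N₁) ⟩
    length (V N₁) + length (V N₂)   ≤⟨ +-mono-≤ (length-V≤rulesSize N₁ (proj₁ (proj₁ g₁)))
                                                (length-V≤rulesSize N₂ (proj₁ (proj₁ g₂))) ⟩
    rulesSize N₁ + rulesSize N₂     ≤⟨ +-mono-≤ (m≤n+m _ (length (S N₁))) (m≤n+m _ (length (S N₂))) ⟩
    size N₁ + size N₂               ∎
    where open ≤-Reasoning

  bound : size M ≤ 4 * (size N₁ + size N₂)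
  bound = begin
    (1 + 1) + rulesSize I₂.system
      ≤⟨ +-mono-≤ (+-mono-≤ (generated-≢[]⇒1≤size g₁ w₁≢[]) (generated-≢[]⇒1≤size g₂ w₂≢[]))
           (≤-trans I₂.size-rule (+-monoˡ-≤ _ (≤-trans I₁.size-rule (+-monoˡ-≤ _ H-size)))) ⟩
    (x + y) + (((x + y) + 2 * x) + 2 * y) ≡⟨ collect x y ⟩
    4 * (x + y)                           ∎
    where
    open ≤-Reasoning
    x = size N₁
    y = size N₂
    collect : ∀ x y → (x + y) + (((x + y) + 2 * x) + 2 * y) ≡ 4 * (x + y)
    collect = solve-∀

composition : ∀ {N₁ N₂ w₁} → Generates N₁ w₁ → w₁ ≢ [] → All (_∈ V N₂) w₁ →
              Generates (withAxiom N₂ w₁) w →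
              ∃[ M ] (Generates M w × size M ≤ 4 * (size N₁ + size N₂))
composition {N₁ = N₁} {N₂} {w₁} g₁ w₁≢[] w₁⊆V₂ (H-valid , L , L-level , n≤ , refl) =
  M , (reaxiom-valid (I.handle∈V ∷ []) I.valid , L , level L-level , n≤ , sym coded) , bound
  where
  H = withAxiom N₂ w₁

  module I = Imported (import-string H-valid g₁ w₁≢[] w₁⊆V₂)
  open Closure H (proj₁ H-valid)

  M = reaxiom I.system (I.handle ∷ []) (suc (d H)) (n H)

  H⊆M : Extends H M
  H⊆M = Extends-trans I.extends reaxiom-extends

  level : Level H k s → Level M (suc k) s
  level L0 = subst (Level M 1) (++-identityʳ w₁) (LS L0
    (step∷ (Lift.rule-lift (proj₁ I.valid) reaxiom-extends I.handle∈V I.resolves) step[]))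
  level (LS p q) = LS (level p) (Lift.step-lift (proj₁ H-valid) H⊆M (level-closed p) q)

  coded : map (τ M) (take (n H) L) ≡ map (τ H) (take (n H) L)
  coded = map-cong-local (All.map (Extends.τ≡ H⊆M) (Allₚ.take⁺ (n H) (level-closed L-level)))

  bound : size M ≤ 4 * (size N₁ + size N₂)
  bound = begin
    1 + rulesSize I.system     ≤⟨ +-mono-≤ (generated-≢[]⇒1≤size g₁ w₁≢[]) I.size-rule ⟩
    x + (rulesSize N₂ + 2 * x) ≤⟨ +-monoʳ-≤ x (+-monoˡ-≤ (2 * x) (m≤n+m _ (length (S N₂)))) ⟩
    x + (y + 2 * x)            ≤⟨ m≤m+n _ (x + 3 * y) ⟩
    x + (y + 2 * x) + (x + 3 * y) ≡⟨ collect x y ⟩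
    4 * (x + y)                ∎
    where
    open ≤-Reasoning
    x = size N₁
    y = size N₂
    collect : ∀ x y → x + (y + 2 * x) + (x + 3 * y) ≡ 4 * (x + y)
    collect = solve-∀

theorem9 : ∃[ c ] (∀ (N₁ N₂ : NU) (w₁ w₂ : List ℕ) →
    Generates N₁ w₁ → Generates N₂ w₂ →
    (∃[ N ] (Generates N (w₁ ++ w₂) × size N ≤ c * (size N₁ + size N₂)))
    × (All (_∈ V N₂) w₁ → ∀ (w : List ℕ) → Generates (withAxiom N₂ w₁) w →
    ∃[ N ] (Generates N w × size N ≤ c * (size N₁ + size N₂))))
theorem9 = 4 , λ N₁ N₂ w₁ w₂ g₁ g₂ → concatenate N₁ N₂ w₁ w₂ g₁ g₂ , compose N₁ N₂ w₁ g₁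
  where
  ≤4* : ∀ {m k} → m ≤ k → m ≤ 4 * k
  ≤4* {m} {k} m≤k = ≤-trans m≤k (m≤m+n k (3 * k))

  concatenate : ∀ N₁ N₂ w₁ w₂ → Generates N₁ w₁ → Generates N₂ w₂ →
                ∃[ N ] (Generates N (w₁ ++ w₂) × size N ≤ 4 * (size N₁ + size N₂))
  concatenate N₁ N₂ []         w₂         g₁ g₂ = N₂ , g₂ , ≤4* (m≤n+m (size N₂) (size N₁))
  concatenate N₁ N₂ w₁@(_ ∷ _) []         g₁ g₂ =
    N₁ , subst (Generates N₁) (sym (++-identityʳ w₁)) g₁ , ≤4* (m≤m+n (size N₁) (size N₂))
  concatenate N₁ N₂ (_ ∷ _)    (_ ∷ _)    g₁ g₂ = concatenation g₁ g₂ (λ ()) (λ ())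

  compose : ∀ N₁ N₂ w₁ → Generates N₁ w₁ → All (_∈ V N₂) w₁ →
            ∀ w → Generates (withAxiom N₂ w₁) w →
            ∃[ N ] (Generates N w × size N ≤ 4 * (size N₁ + size N₂))
  compose N₁ N₂ []      g₁ w₁⊆V₂ w g =
    withAxiom N₂ [] , g , ≤4* (≤-trans (m≤n+m _ (length (S N₂))) (m≤n+m _ (size N₁)))
  compose N₁ N₂ (_ ∷ _) g₁ w₁⊆V₂ w g = composition {N₂ = N₂} g₁ (λ ()) w₁⊆V₂ g
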